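{- Let $G=(V,E)$ be a finite simple undirected graph with $c(G)>1$ and let $\gamma\in(0,1)$. Then there exists an initial state $s_0\in S$ such that $\Gamma_3(G|s_0)$ has a noncapturing Nash equilibrium $\widehat{\sigma}$ (in deterministic strategies), i.e. a Nash equilibrium under which the play from $s_0$ never reaches a capture state.
   Context: Game $\Gamma_3(G|s_0)$. $N[x]$ is the closed neighborhood of $x$ in $G$. Nonterminal states: $S=\{(x^1,x^2,x^3,p): x^i\in V,\ p\in\{1,2,3\}\}$, where $x^i$ is the vertex of player $P_i$ and $p$ is the index of the player who moves next. There is one additional terminal state $\overline{s}$. Capture sets: $\widetilde{S}^1=\{s\in S: x^1=x^2\}$ ($P_1$ captures $P_2$), $\widetilde{S}^2=\{s\in S: x^2=x^3\}$ ($P_2$ captures $P_3$); the set of capture states is $S_C=\widetilde{S}^1\cup\widetilde{S}^2$, and $S_{NC}=S\setminus S_C$. Action sets: for $s=(x^1,x^2,x^3,p)\in S_{NC}$, $A^p(s)=N[x^p]$ and $A^m(s)=\{x^m\}$ for $m\neq p$; for $s\in S_C\cup\{\overline{s}\}$, $A^m(s)=\{\lambda\}$ (null move). Transitions: for $s=(x^1,x^2,x^3,n)\in S_{NC}$ and $a\in A^n(s)$, $\mathbf{T}(s,a)$ is obtained by replacing $x^n$ by $a$ and letting the next mover be $n+1$ (or $1$ if $n=3$). For $s\in S_C\cup\{\overline{s}\}$, $\mathbf{T}(s,\lambda)=\overline{s}$. Strategies: a deterministic strategy $\sigma^n$ assigns to each finite history $s_0s_1\dots s_t$ ($t\ge0$)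 an action in $A^n(s_t)$. A profile $\sigma$ and a starting state $s_0$ determine a play $s_0s_1s_2\dots$ with $s_{t+1}=\mathbf{T}(s_t,a)$, $a$ being the action chosen by the player who has the move (and $a=\lambda$ when $s_t\in S_C\cup\{\overline{s}\}$). $\sigma^{ -n}$ denotes the strategies of the players other than $P_n$. Turn payoffs: $q^1(s)=1$ if $s\in\widetilde{S}^1$, else $0$; $q^2(s)=-1$ if $s\in\widetilde{S}^1$, $1$ if $s\in\widetilde{S}^2\setminus\widetilde{S}^1$, else $0$; $q^3(s)=-1$ if $s\in\widetilde{S}^2\setminus\widetilde{S}^1$, else $0$. Total payoffs: $Q^n(s_0,\sigma)=\sum_{t=0}^\infty\gamma^tq^n(s_t)$. A Nash equilibrium of $\Gamma_3(G|s_0)$ is a profile $\widehat\sigma$ with $Q^n(s_0,\widehat\sigma)\ge Q^n(s_0,\sigma^n,\widehat\sigma^{ -n})$ for all $n\in\{1,2,3\}$ and all $\sigma^n$. Cop number: in the classic Cops and Robbers game on $G$, the cop player first places $k$ cop tokens on vertices, then the robber player, seeing this, places the robber; afterwards they alternate, the cop player moving each cop token to a vertex in the closed neighborhood of its position, then the robber player likewise moving the robber. Cops win if at some time a cop token and the robber are on the same vertex. $c(G)$ is the smallest $k$ for which the cop player can guarantee capture. -}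

module Defs where

open import Data.Bool.Base using (true; false; if_then_else_)
open import Data.Fin.Base using (Fin; zero; suc)
open import Data.Fin.Properties using (_≟_)
import Data.Integer.Base as ℤ
import Data.Integer.Properties as ℤ
open import Data.List.NonEmpty using (List⁺; [_]; _∷⁺_; head)
open import Data.Nat.Base as ℕ using (ℕ; zero; suc)
import Data.Nat.Properties as ℕ
import Data.Nat.Coprimality as C
open import Data.Product using (Σ-syntax; ∃-syntax; _×_; _,_; proj₁; proj₂)
open import Data.Rational using (ℚ; mkℚ; 0ℚ; 1ℚ; ½; _+_; _*_; _-_; -_; ∣_∣; 1/_; _≤_; _<_; *≤*; _/_; ↥_; Positive; NonNegative; positive; nonNegative)
open import Data.Rational.Properties hiding (_≟_)
open import Data.Rational.Solver using (module +-*-Solver)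
open import Data.Sum.Base using (_⊎_; inj₁; inj₂)
open import Data.Vec.Base using (Vec)
open import Data.Vec.Membership.Propositional renaming (_∈_ to _∈ᵛ_)
open import Data.Vec.Relation.Binary.Pointwise.Inductive using (Pointwise)
open import Level using (0ℓ)
open import Relation.Binary.Core using (Rel)
open import Relation.Binary.Definitions using (Symmetric; Irreflexive; Decidable)
open import Relation.Binary.PropositionalEquality using (_≡_; _≢_; refl; sym; trans; cong; cong₂; subst)
open import Relation.Unary using (Pred; _∈_)
open import Relation.Nullary using (¬_; yes; no; does)

open +-*-Solver using (solve; _:=_; _:+_; _:*_; _:-_; :-_; con)

private

  swap-≡ : ∀ p q → p - q ≡ - (q - p)
  swap-≡ = solve 2 (λ p q → p :- q := :- (q :- p)) refl

  restore : ∀ p q → p ≡ q + (p - q)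
  restore = solve 2 (λ p q → p := q :+ (p :- q)) refl

  insert : ∀ p q r → p - r ≡ (p - q) + (q - r)
  insert = solve 3 (λ p q r → p :- r := (p :- q) :+ (q :- r)) refl

  interchange : ∀ p q r s → (p + q) - (r + s) ≡ (p - r) + (q - s)
  interchange = solve 4 (λ p q r s → (p :+ q) :- (r :+ s) := (p :- r) :+ (q :- s)) refl

  telescope : ∀ δ u v → (u - v) + v * δ ≡ u - (1ℚ - δ) * v
  telescope = solve 3 (λ δ u v → (u :- v) :+ v :* δ := u :- (con 1ℚ :- δ) :* v) refl

  bernoulli-step : ∀ δ m v →
    (1ℚ - δ) * v * (1ℚ + (m + 1ℚ) * δ) ≡ v * (1ℚ + m * δ) - v * ((m + 1ℚ) * (δ * δ))
  bernoulli-step = solve 3 (λ δ m v →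
    (con 1ℚ :- δ) :* v :* (con 1ℚ :+ (m :+ con 1ℚ) :* δ)
      := v :* (con 1ℚ :+ m :* δ) :- v :* ((m :+ con 1ℚ) :* (δ :* δ))) refl

  *-diff : ∀ p q r s → p * q - r * s ≡ (q - s) * p + (p - r) * s
  *-diff = solve 4 (λ p q r s → p :* q :- r :* s := (q :- s) :* p :+ (p :- r) :* s) refl

  cancel : ∀ p q → (p + q) - q ≡ p
  cancel = solve 2 (λ p q → (p :+ q) :- q := p) refl

  regroup : ∀ p q r → (p + q) - r ≡ (p - r) + q
  regroup = solve 3 (λ p q r → (p :+ q) :- r := (p :- r) :+ q) refl

  shuffle : ∀ p q → p + (q + p) ≡ q + (p + p)
  shuffle = solve 2 (λ p q → p :+ (q :+ p) := q :+ (p :+ p)) refl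

  p≤p+q : ∀ p q → 0ℚ ≤ q → p ≤ p + q
  p≤p+q p q 0≤q = subst (_≤ p + q) (+-identityʳ p) (+-monoʳ-≤ p 0≤q)

  p≤q+p : ∀ p q → 0ℚ ≤ q → p ≤ q + p
  p≤q+p p q 0≤q = subst (p ≤_) (+-comm p q) (p≤p+q p q 0≤q)

  p-q≤p : ∀ p q → 0ℚ ≤ q → p - q ≤ p
  p-q≤p p q 0≤q = subst (p - q ≤_) (+-identityʳ p) (+-monoʳ-≤ p (neg-antimono-≤ 0≤q))

  p≤∣p∣ : ∀ p → p ≤ ∣ p ∣
  p≤∣p∣ p with ≤-total 0ℚ p
  ... | inj₁ 0≤p = ≤-reflexive (sym (0≤p⇒∣p∣≡p 0≤p))
  ... | inj₂ p≤0 = ≤-trans p≤0 (0≤∣p∣ p)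

  ∣p-q∣≡∣q-p∣ : ∀ p q → ∣ p - q ∣ ≡ ∣ q - p ∣
  ∣p-q∣≡∣q-p∣ p q = trans
    (cong ∣_∣ (swap-≡ p q))
    (∣-p∣≡∣p∣ (q - p))

  close⇒≤ : ∀ {p q ε} → ∣ p - q ∣ ≤ ε → p ≤ q + ε
  close⇒≤ {p} {q} {ε} h = begin
    p            ≡⟨ restore p q ⟩
    q + (p - q)  ≤⟨ +-monoʳ-≤ q (≤-trans (p≤∣p∣ (p - q)) h) ⟩
    q + ε        ∎
    where open ≤-Reasoning

  triangle : ∀ p q r → ∣ p - r ∣ ≤ ∣ p - q ∣ + ∣ q - r ∣
  triangle p q r = begin
    ∣ p - r ∣              ≡⟨ cong ∣_∣ (insert p q r) ⟩
    ∣ (p - q) + (q - r) ∣  ≤⟨ ∣p+q∣≤∣p∣+∣q∣ (p - q) (q - r) ⟩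
    ∣ p - q ∣ + ∣ q - r ∣  ∎
    where open ≤-Reasoning

  half : ℚ → ℚ
  half ε = ½ * ε

  half+half : ∀ ε → half ε + half ε ≡ ε
  half+half ε = trans (sym (*-distribʳ-+ ε ½ ½)) (*-identityˡ ε)

  *-pos : ∀ {p q} → 0ℚ < p → 0ℚ < q → 0ℚ < p * q
  *-pos {p} {q} 0<p 0<q =
    subst (_< p * q) (*-zeroʳ p) (*-monoʳ-<-pos p {{positive 0<p}} 0<q)

  *-nonNeg : ∀ {p q} → 0ℚ ≤ p → 0ℚ ≤ q → 0ℚ ≤ p * q
  *-nonNeg {p} {q} 0≤p 0≤q =
    subst (_≤ p * q) (*-zeroʳ p) (*-monoˡ-≤-nonNeg p {{nonNegative 0≤p}} 0≤q)

  half-pos : ∀ {ε} → 0ℚ < ε → 0ℚ < half ε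
  half-pos = *-pos {½} (positive⁻¹ ½)

  *-mono-nonNeg : ∀ {p q r s} → 0ℚ ≤ r → 0ℚ ≤ q → p ≤ q → r ≤ s → p * r ≤ q * s
  *-mono-nonNeg {p} {q} {r} {s} 0≤r 0≤q p≤q r≤s = ≤-trans
    (*-monoʳ-≤-nonNeg r {{nonNegative 0≤r}} p≤q)
    (*-monoˡ-≤-nonNeg q {{nonNegative 0≤q}} r≤s)

  quotient : ∀ {b ε} → 0ℚ < b → 0ℚ < ε → ∃[ η ] (0ℚ < η × η * b ≡ ε)
  quotient {b} {ε} 0<b 0<ε =
    ε * inv , *-pos 0<ε (positive⁻¹ inv {{1/pos⇒pos b {{bpos}}}}) ,
    trans (*-assoc ε inv b)
      (trans (cong (ε *_) (*-inverseˡ b {{b≢0}})) (*-identityʳ ε))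
    where
    bpos : Positive b
    bpos = positive 0<b
    b≢0 = pos⇒nonZero b {{bpos}}
    inv = (1/ b) {{b≢0}}

Eventually : (ℕ → Set) → Set
Eventually P = ∃[ N ] (∀ n → N ℕ.≤ n → P n)

-- The reals are Cauchy sequences of rationals; as for any representation by
-- sequences, _≤ᴿ_ and _<ᴿ_ (not _≡_) are the meaningful relations on them.

IsCauchy : (ℕ → ℚ) → Set
IsCauchy x = ∀ ε → 0ℚ < ε →
  ∃[ N ] (∀ m n → N ℕ.≤ m → N ℕ.≤ n → ∣ x m - x n ∣ ≤ ε)

record ℝ : Set where
  constructor mkℝ
  field
    approx : ℕ → ℚ
    cauchy : IsCauchy approx

open ℝ public

infix 4 _≤ᴿ_ _<ᴿ_

_≤ᴿ_ : Rel ℝ 0ℓ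
x ≤ᴿ y = ∀ ε → 0ℚ < ε → Eventually (λ k → approx x k ≤ approx y k + ε)

_<ᴿ_ : Rel ℝ 0ℓ
x <ᴿ y = ∃[ δ ] (0ℚ < δ × Eventually (λ k → approx x k + δ ≤ approx y k))

fromℚ : ℚ → ℝ
fromℚ p = mkℝ (λ _ → p) λ ε 0<ε → 0 , λ _ _ _ _ →
  ≤-trans (≤-reflexive (cong ∣_∣ (+-inverseʳ p))) (<⇒≤ 0<ε)

0ᴿ 1ᴿ : ℝ
0ᴿ = fromℚ 0ℚ
1ᴿ = fromℚ 1ℚ

private

  +-cauchy : ∀ {x y} → IsCauchy x → IsCauchy y → IsCauchy (λ k → x k + y k)
  +-cauchy {x} {y} cx cy ε 0<ε
    with M , hx ← cx (half ε) (half-pos 0<ε) | N , hy ← cy (half ε) (half-pos 0<ε)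
    = M ℕ.⊔ N , λ m n le₁ le₂ → begin
      ∣ (x m + y m) - (x n + y n) ∣
        ≡⟨ cong ∣_∣ (interchange (x m) (y m) (x n) (y n)) ⟩
      ∣ (x m - x n) + (y m - y n) ∣
        ≤⟨ ∣p+q∣≤∣p∣+∣q∣ (x m - x n) (y m - y n) ⟩
      ∣ x m - x n ∣ + ∣ y m - y n ∣
        ≤⟨ +-mono-≤ (hx m n (ℕ.m⊔n≤o⇒m≤o M N le₁) (ℕ.m⊔n≤o⇒m≤o M N le₂))
                    (hy m n (ℕ.m⊔n≤o⇒n≤o M N le₁) (ℕ.m⊔n≤o⇒n≤o M N le₂)) ⟩
      half ε + half ε
        ≡⟨ half+half ε ⟩
      ε ∎
    where open ≤-Reasoning

  eventually-bounded : ∀ {x} → IsCauchy x →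
    ∃[ B ] (0ℚ < B × Eventually (λ k → ∣ x k ∣ ≤ B))
  eventually-bounded {x} cx with N , h ← cx 1ℚ (positive⁻¹ 1ℚ) =
    1ℚ + ∣ x N ∣ , +-mono-<-≤ (positive⁻¹ 1ℚ) (0≤∣p∣ (x N)) , N , λ k le → begin
      ∣ x k ∣                  ≡⟨ cong ∣_∣ (trans (restore (x k) (x N)) (+-comm (x N) (x k - x N))) ⟩
      ∣ (x k - x N) + x N ∣    ≤⟨ ∣p+q∣≤∣p∣+∣q∣ (x k - x N) (x N) ⟩
      ∣ x k - x N ∣ + ∣ x N ∣  ≤⟨ +-monoˡ-≤ ∣ x N ∣ (h k N le ℕ.≤-refl) ⟩
      1ℚ + ∣ x N ∣             ∎
    where open ≤-Reasoning

  *-close : ∀ p q r s η A θ B →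
    ∣ q - s ∣ ≤ η → ∣ p ∣ ≤ A → ∣ p - r ∣ ≤ θ → ∣ s ∣ ≤ B →
    ∣ p * q - r * s ∣ ≤ η * A + θ * B
  *-close p q r s η A θ B q~s p≤A p~r s≤B = begin
    ∣ p * q - r * s ∣
      ≡⟨ cong ∣_∣ (*-diff p q r s) ⟩
    ∣ (q - s) * p + (p - r) * s ∣
      ≤⟨ ∣p+q∣≤∣p∣+∣q∣ ((q - s) * p) ((p - r) * s) ⟩
    ∣ (q - s) * p ∣ + ∣ (p - r) * s ∣
      ≡⟨ cong₂ _+_ (∣p*q∣≡∣p∣*∣q∣ (q - s) p) (∣p*q∣≡∣p∣*∣q∣ (p - r) s) ⟩
    ∣ q - s ∣ * ∣ p ∣ + ∣ p - r ∣ * ∣ s ∣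
      ≤⟨ +-mono-≤
           (*-mono-nonNeg {∣ q - s ∣} {η} {∣ p ∣} {A} (0≤∣p∣ p) (≤-trans (0≤∣p∣ (q - s)) q~s) q~s p≤A)
           (*-mono-nonNeg {∣ p - r ∣} {θ} {∣ s ∣} {B} (0≤∣p∣ s) (≤-trans (0≤∣p∣ (p - r)) p~r) p~r s≤B) ⟩
    η * A + θ * B ∎
    where open ≤-Reasoning

  *-cauchy : ∀ {x y} → IsCauchy x → IsCauchy y → IsCauchy (λ k → x k * y k)
  *-cauchy {x} {y} cx cy ε 0<ε =
    let A , 0<A , L , bx = eventually-bounded cx
        B , 0<B , K , by = eventually-bounded cy
        η , 0<η , ηA     = quotient 0<A (half-pos 0<ε)
        θ , 0<θ , θB     = quotient 0<B (half-pos 0<ε)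
        M , hx           = cx θ 0<θ
        N , hy           = cy η 0<η
    in (L ℕ.⊔ K) ℕ.⊔ (M ℕ.⊔ N) , λ m n le₁ le₂ →
      let le₁′ = ℕ.m⊔n≤o⇒n≤o (L ℕ.⊔ K) (M ℕ.⊔ N) le₁
          le₂′ = ℕ.m⊔n≤o⇒n≤o (L ℕ.⊔ K) (M ℕ.⊔ N) le₂
          le₁″ = ℕ.m⊔n≤o⇒m≤o (L ℕ.⊔ K) (M ℕ.⊔ N) le₁
          le₂″ = ℕ.m⊔n≤o⇒m≤o (L ℕ.⊔ K) (M ℕ.⊔ N) le₂
      in ≤-trans
        (*-close (x m) (y m) (x n) (y n) η A θ B
          (hy m n (ℕ.m⊔n≤o⇒n≤o M N le₁′) (ℕ.m⊔n≤o⇒n≤o M N le₂′))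
          (bx m (ℕ.m⊔n≤o⇒m≤o L K le₁″))
          (hx m n (ℕ.m⊔n≤o⇒m≤o M N le₁′) (ℕ.m⊔n≤o⇒m≤o M N le₂′))
          (by n (ℕ.m⊔n≤o⇒n≤o L K le₂″)))
        (≤-reflexive (trans (cong₂ _+_ ηA θB) (half+half ε)))

infixl 6 _+ᴿ_
infixl 7 _*ᴿ_
infixr 8 _^ᴿ_

_+ᴿ_ _*ᴿ_ : ℝ → ℝ → ℝ
approx (x +ᴿ y) k = approx x k + approx y k
cauchy (x +ᴿ y)   = +-cauchy {approx x} {approx y} (cauchy x) (cauchy y)
approx (x *ᴿ y) k = approx x k * approx y k
cauchy (x *ᴿ y)   = *-cauchy {approx x} {approx y} (cauchy x) (cauchy y)

_^ᴿ_ : ℝ → ℕ → ℝ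
x ^ᴿ zero  = 1ᴿ
x ^ᴿ suc t = x *ᴿ (x ^ᴿ t)

_⟶_ : (ℕ → ℝ) → ℝ → Set
a ⟶ l = ∀ ε → 0ℚ < ε →
  Eventually (λ n → (a n ≤ᴿ l +ᴿ fromℚ ε) × (l ≤ᴿ a n +ᴿ fromℚ ε))

partialSum : (ℕ → ℝ) → ℕ → ℝ
partialSum a zero    = 0ᴿ
partialSum a (suc n) = partialSum a n +ᴿ a n

HasSum : (ℕ → ℝ) → ℝ → Set
HasSum a l = partialSum a ⟶ l

private

  pow : ℚ → ℕ → ℚ
  pow r zero    = 1ℚ
  pow r (suc n) = r * pow r n

  ι : ℕ → ℚ
  ι zero    = 0ℚ
  ι (suc n) = ι n + 1ℚ

  n/1≡ : ∀ n → ℤ.+ n / 1 ≡ mkℚ (ℤ.+ n) 0 (C.sym (C.1-coprimeTo n))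
  n/1≡ n = normalize-coprime (C.sym (C.1-coprimeTo n))

  ι≡ : ∀ n → ι n ≡ ℤ.+ n / 1
  ι≡ zero    = refl
  ι≡ (suc n) = trans (cong (_+ 1ℚ) (trans (ι≡ n) (n/1≡ n)))
    (cong (_/ 1) {ℤ.+ n ℤ.* ℤ.+ 1 ℤ.+ ℤ.+ 1} {ℤ.+ suc n}
      (trans (cong (ℤ._+ ℤ.+ 1) (ℤ.*-identityʳ (ℤ.+ n))) (ℤ.+-comm (ℤ.+ n) (ℤ.+ 1))))

  0≤ι : ∀ n → 0ℚ ≤ ι n
  0≤ι zero    = ≤-refl
  0≤ι (suc n) = +-mono-≤ (0≤ι n) (<⇒≤ (positive⁻¹ 1ℚ))

  ≤-numerator : ∀ p → p ≤ ι ℤ.∣ ↥ p ∣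
  ≤-numerator p@(mkℚ (ℤ.+ n) d _) =
    subst (p ≤_) (sym (trans (ι≡ n) (n/1≡ n)))
      (*≤* (ℤ.*-monoˡ-≤-nonNeg (ℤ.+ n) (ℤ.+≤+ (ℕ.s≤s (ℕ.z≤n {d})))))
  ≤-numerator p@(mkℚ ℤ.-[1+ n ] d _) = ≤-trans (nonPositive⁻¹ p) (0≤ι (suc n))

  archimedean : ∀ {e} → 0ℚ < e → ∃[ n ] (1ℚ ≤ ι n * e)
  archimedean {e} 0<e with η , 0<η , ηe≡1 ← quotient 0<e (positive⁻¹ 1ℚ) =
    ℤ.∣ ↥ η ∣ , subst (_≤ ι ℤ.∣ ↥ η ∣ * e) ηe≡1
      (*-monoʳ-≤-nonNeg e {{nonNegative (<⇒≤ 0<e)}} (≤-numerator η))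

  module Powers (δ : ℚ) (0<δ : 0ℚ < δ) (0≤r : 0ℚ ≤ 1ℚ - δ) where

    r = 1ℚ - δ

    0≤pow : ∀ n → 0ℚ ≤ pow r n
    0≤pow zero    = <⇒≤ (positive⁻¹ 1ℚ)
    0≤pow (suc n) = *-nonNeg {r} {pow r n} 0≤r (0≤pow n)

    bernoulli : ∀ n → pow r n * (1ℚ + ι n * δ) ≤ 1ℚ
    bernoulli zero    = ≤-reflexive (trans (*-identityˡ _) (trans (cong (1ℚ +_) (*-zeroˡ δ)) (+-identityʳ 1ℚ)))
    bernoulli (suc n) = begin
      r * pow r n * (1ℚ + (ι n + 1ℚ) * δ)      ≡⟨ bernoulli-step δ (ι n) (pow r n) ⟩
      u - w                                    ≤⟨ p-q≤p u w 0≤w ⟩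
      u                                        ≤⟨ bernoulli n ⟩
      1ℚ                                       ∎
      where
      open ≤-Reasoning
      u = pow r n * (1ℚ + ι n * δ)
      w = pow r n * ((ι n + 1ℚ) * (δ * δ))
      0≤w : 0ℚ ≤ w
      0≤w = *-nonNeg {pow r n} (0≤pow n)
        (*-nonNeg {ι n + 1ℚ} (0≤ι (suc n)) (*-nonNeg {δ} {δ} (<⇒≤ 0<δ) (<⇒≤ 0<δ)))

    pow-small : ∀ η → 0ℚ < η → ∃[ n ] (pow r n ≤ η)
    pow-small η 0<η with n , h ← archimedean (*-pos {δ} {η} 0<δ 0<η) =
      n , *-cancelʳ-≤-pos d {{positive 0<d}} (begin
        pow r n * d      ≤⟨ bernoulli n ⟩
        1ℚ               ≤⟨ h ⟩
        ι n * (δ * η)    ≡⟨ sym (*-assoc (ι n) δ η) ⟩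
        ι n * δ * η      ≤⟨ *-monoʳ-≤-nonNeg η {{nonNegative (<⇒≤ 0<η)}} (p≤q+p (ι n * δ) 1ℚ (<⇒≤ (positive⁻¹ 1ℚ))) ⟩
        d * η            ≡⟨ *-comm d η ⟩
        η * d            ∎)
      where
      open ≤-Reasoning
      d = 1ℚ + ι n * δ
      0<d : 0ℚ < d
      0<d = +-mono-<-≤ (positive⁻¹ 1ℚ) (*-nonNeg {ι n} {δ} (0≤ι n) (<⇒≤ 0<δ))

  module Series (γ : ℝ) (0<γ : 0ᴿ <ᴿ γ) (γ<1 : γ <ᴿ 1ᴿ)
                (c : ℕ → ℚ) (∣c∣≤1 : ∀ t → ∣ c t ∣ ≤ 1ℚ) where

    term : ℕ → ℝ
    term t = γ ^ᴿ t *ᴿ fromℚ (c t)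

    S : ℕ → ℕ → ℚ
    S n k = approx (partialSum term n) k

    δ = proj₁ γ<1

    0<δ : 0ℚ < δ
    0<δ = proj₁ (proj₂ γ<1)

    bounds : Eventually (λ k → 0ℚ ≤ approx γ k × approx γ k ≤ 1ℚ - δ)
    bounds = N ℕ.⊔ M , λ k le →
      ≤-trans (<⇒≤ 0<η) (subst (_≤ approx γ k) (+-identityˡ η) (f k (ℕ.m⊔n≤o⇒m≤o N M le))) ,
      subst (_≤ 1ℚ - δ) (cancel (approx γ k) δ) (+-monoˡ-≤ (- δ) (g k (ℕ.m⊔n≤o⇒n≤o N M le)))
      where
      η = proj₁ 0<γ
      0<η : 0ℚ < η
      0<η = proj₁ (proj₂ 0<γ)
      N = proj₁ (proj₂ (proj₂ 0<γ))
      f = proj₂ (proj₂ (proj₂ 0<γ))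
      M = proj₁ (proj₂ (proj₂ γ<1))
      g = proj₂ (proj₂ (proj₂ γ<1))

    K = proj₁ bounds

    0≤r : 0ℚ ≤ 1ℚ - δ
    0≤r = let b = proj₂ bounds K ℕ.≤-refl in ≤-trans (proj₁ b) (proj₂ b)

    open Powers δ 0<δ 0≤r

    γᵏ : ℕ → ℕ → ℚ
    γᵏ n k = approx (γ ^ᴿ n) k

    γᵏ-bounds : ∀ n k → K ℕ.≤ k → 0ℚ ≤ γᵏ n k × γᵏ n k ≤ pow r n
    γᵏ-bounds zero    k K≤k = <⇒≤ (positive⁻¹ 1ℚ) , ≤-refl
    γᵏ-bounds (suc n) k K≤k =
      let 0≤γ , γ≤r = proj₂ bounds k K≤k
          0≤g , g≤p = γᵏ-bounds n k K≤k
      in *-nonNeg {approx γ k} {γᵏ n k} 0≤γ 0≤g ,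
         *-mono-nonNeg {approx γ k} {r} {γᵏ n k} {pow r n} 0≤g 0≤r γ≤r g≤p

    ∣term∣ : ∀ n k → K ℕ.≤ k → ∣ γᵏ n k * c n ∣ ≤ pow r n
    ∣term∣ n k K≤k = let 0≤g , g≤p = γᵏ-bounds n k K≤k in begin
      ∣ γᵏ n k * c n ∣      ≡⟨ ∣p*q∣≡∣p∣*∣q∣ (γᵏ n k) (c n) ⟩
      ∣ γᵏ n k ∣ * ∣ c n ∣  ≡⟨ cong (_* ∣ c n ∣) (0≤p⇒∣p∣≡p 0≤g) ⟩
      γᵏ n k * ∣ c n ∣      ≤⟨ *-mono-nonNeg {γᵏ n k} {pow r n} {∣ c n ∣} {1ℚ} (0≤∣p∣ (c n)) (0≤pow n) g≤p (∣c∣≤1 n) ⟩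
      pow r n * 1ℚ          ≡⟨ *-identityʳ (pow r n) ⟩
      pow r n               ∎
      where open ≤-Reasoning

    gap : ℕ → ℕ → ℕ → ℚ
    gap m n k = ∣ S n k - S m k ∣

    gap-bound : ∀ {m n} → m ℕ.≤′ n → ∀ k → K ℕ.≤ k → gap m n k * δ ≤ pow r m - pow r n
    gap-bound {m} ℕ.≤′-refl k K≤k = ≤-reflexive (trans
      (cong (λ q → ∣ q ∣ * δ) (+-inverseʳ (S m k)))
      (trans (*-zeroˡ δ) (sym (+-inverseʳ (pow r m)))))
    gap-bound {m} (ℕ.≤′-step {n} m≤n) k K≤k = begin
      ∣ S n k + a - S m k ∣ * δ
        ≡⟨ cong (λ q → ∣ q ∣ * δ) (regroup (S n k) a (S m k)) ⟩
      ∣ (S n k - S m k) + a ∣ * δ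
        ≤⟨ *-monoʳ-≤-nonNeg δ {{nonNegative (<⇒≤ 0<δ)}} (∣p+q∣≤∣p∣+∣q∣ (S n k - S m k) a) ⟩
      (gap m n k + ∣ a ∣) * δ
        ≡⟨ *-distribʳ-+ δ (gap m n k) ∣ a ∣ ⟩
      gap m n k * δ + ∣ a ∣ * δ
        ≤⟨ +-mono-≤ (gap-bound m≤n k K≤k)
             (*-monoʳ-≤-nonNeg δ {{nonNegative (<⇒≤ 0<δ)}} (∣term∣ n k K≤k)) ⟩
      (pow r m - pow r n) + pow r n * δ
        ≡⟨ telescope δ (pow r m) (pow r n) ⟩
      pow r m - pow r (suc n) ∎
      where
      open ≤-Reasoning
      a = γᵏ n k * c n

    tail-small : ∀ ε → 0ℚ < ε →
      ∃[ m ] (∀ n k → m ℕ.≤ n → K ℕ.≤ k → gap m n k ≤ ε)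
    tail-small ε 0<ε = m , λ n k m≤n K≤k → *-cancelʳ-≤-pos {gap m n k} {ε} δ {{positive 0<δ}}
      (≤-trans (gap-bound (ℕ.≤⇒≤′ m≤n) k K≤k)
        (≤-trans (p-q≤p (pow r m) (pow r n) (0≤pow n)) small))
      where
      0<εδ : 0ℚ < ε * δ
      0<εδ = *-pos {ε} {δ} 0<ε 0<δ
      m = proj₁ (pow-small (ε * δ) 0<εδ)
      small : pow r m ≤ ε * δ
      small = proj₂ (pow-small (ε * δ) 0<εδ)

    diagonal-cauchy : IsCauchy (λ k → S k k)
    diagonal-cauchy ε 0<ε =
      let ε′ = half ε
          ε″ = half ε′
          0<ε′ = half-pos 0<ε
          T , tail = tail-small ε″ (half-pos 0<ε′)
          N , cau  = cauchy (partialSum term T) ε′ 0<ε′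
      in T ℕ.⊔ (K ℕ.⊔ N) , λ m n le₁ le₂ →
        let Tm = ℕ.m⊔n≤o⇒m≤o T (K ℕ.⊔ N) le₁
            Tn = ℕ.m⊔n≤o⇒m≤o T (K ℕ.⊔ N) le₂
            KNm = ℕ.m⊔n≤o⇒n≤o T (K ℕ.⊔ N) le₁
            KNn = ℕ.m⊔n≤o⇒n≤o T (K ℕ.⊔ N) le₂
        in begin
          ∣ S m m - S n n ∣
            ≤⟨ triangle (S m m) (S T m) (S n n) ⟩
          gap T m m + ∣ S T m - S n n ∣
            ≤⟨ +-mono-≤ (tail m m Tm (ℕ.m⊔n≤o⇒m≤o K N KNm)) (begin
                 ∣ S T m - S n n ∣
                   ≤⟨ triangle (S T m) (S T n) (S n n) ⟩
                 ∣ S T m - S T n ∣ + ∣ S T n - S n n ∣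
                   ≤⟨ +-mono-≤ (cau m n (ℕ.m⊔n≤o⇒n≤o K N KNm) (ℕ.m⊔n≤o⇒n≤o K N KNn))
                        (≤-trans (≤-reflexive (∣p-q∣≡∣q-p∣ (S T n) (S n n)))
                          (tail n n Tn (ℕ.m⊔n≤o⇒m≤o K N KNn))) ⟩
                 ε′ + ε″ ∎) ⟩
          ε″ + (ε′ + ε″)
            ≡⟨ trans (shuffle ε″ ε′) (trans (cong (ε′ +_) (half+half ε′)) (half+half ε)) ⟩
          ε ∎
      where open ≤-Reasoning

    total : ℝ
    total = mkℝ (λ k → S k k) diagonal-cauchy

    total-correct : HasSum term total
    total-correct ε 0<ε =
      let T , tail = tail-small (half ε) (half-pos 0<ε)
          close : ∀ n k → T ℕ.≤ n → T ℕ.≤ k → K ℕ.≤ k → ∣ S n k - S k k ∣ ≤ ε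
          close n k T≤n T≤k K≤k = begin
            ∣ S n k - S k k ∣        ≤⟨ triangle (S n k) (S T k) (S k k) ⟩
            gap T n k + ∣ S T k - S k k ∣
              ≤⟨ +-mono-≤ (tail n k T≤n K≤k)
                   (≤-trans (≤-reflexive (∣p-q∣≡∣q-p∣ (S T k) (S k k))) (tail k k T≤k K≤k)) ⟩
            half ε + half ε          ≡⟨ half+half ε ⟩
            ε                        ∎
      in T , λ n T≤n →
        (λ ε′ 0<ε′ → T ℕ.⊔ K , λ k le →
          ≤-trans (close⇒≤ (close n k T≤n (ℕ.m⊔n≤o⇒m≤o T K le) (ℕ.m⊔n≤o⇒n≤o T K le)))
                  (p≤p+q (S k k + ε) ε′ (<⇒≤ 0<ε′))) ,
        (λ ε′ 0<ε′ → T ℕ.⊔ K , λ k le →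
          ≤-trans (close⇒≤ (≤-trans (≤-reflexive (∣p-q∣≡∣q-p∣ (S k k) (S n k)))
                             (close n k T≤n (ℕ.m⊔n≤o⇒m≤o T K le) (ℕ.m⊔n≤o⇒n≤o T K le))))
                  (p≤p+q (S n k + ε) ε′ (<⇒≤ 0<ε′)))
      where open ≤-Reasoning

-- The real number Σₜ γᵗ cₜ, characterised by discountedSum-HasSum.
abstract

  discountedSum : (γ : ℝ) → 0ᴿ <ᴿ γ → γ <ᴿ 1ᴿ →
    (c : ℕ → ℚ) → (∀ t → ∣ c t ∣ ≤ 1ℚ) → ℝ
  discountedSum = Series.total

  discountedSum-HasSum : ∀ γ 0<γ γ<1 c ∣c∣≤1 →
    HasSum (λ t → γ ^ᴿ t *ᴿ fromℚ (c t)) (discountedSum γ 0<γ γ<1 c ∣c∣≤1)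
  discountedSum-HasSum = Series.total-correct

record Graph : Set₁ where
  field
    order : ℕ

  V : Set
  V = Fin order

  field
    _~_      : Rel V 0ℓ
    _~?_     : Decidable _~_
    ~-sym    : Symmetric _~_
    ~-irrefl : Irreflexive _≡_ _~_

  N[_] : V → Pred V 0ℓ
  N[ x ] y = y ≡ x ⊎ x ~ y

-- Both games below let strategies depend on the whole past.  A history is
-- a nonempty list with the most recent entry first, so its head is the
-- current position or state.

module _ (G : Graph) (k : ℕ) where
  open Graph G

  record Position : Set where
    constructor mkPosition
    field
      cops   : Vec V k
      robber : V

  open Position

  record CopStrategy : Set where
    field
      place : Vec V k
      move  : (h : List⁺ Position) →
              Σ[ xs ∈ Vec V k ] Pointwise (λ x y → y ∈ N[ x ]) (cops (head h)) xs

  record RobberStrategy : Set where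
    field
      place : Vec V k → V
      move  : (h : List⁺ Position) → Vec V k → Σ[ y ∈ V ] y ∈ N[ robber (head h) ]

  module _ (κ : CopStrategy) (ρ : RobberStrategy) where

    rounds : ℕ → List⁺ Position
    rounds zero    = [ mkPosition xs (RobberStrategy.place ρ xs) ]
      where xs = CopStrategy.place κ
    rounds (suc t) = mkPosition xs (proj₁ (RobberStrategy.move ρ (rounds t) xs)) ∷⁺ rounds t
      where xs = proj₁ (CopStrategy.move κ (rounds t))

    -- Capture can occur at the end of round t or right after the cops'
    -- following move.
    CapturedIn : ℕ → Set
    CapturedIn t = robber p ∈ᵛ cops p ⊎ robber p ∈ᵛ proj₁ (CopStrategy.move κ (rounds t))
      where p = head (rounds t)

  CopsGuaranteeCapture : Set
  CopsGuaranteeCapture = Σ[ κ ∈ CopStrategy ] (∀ ρ → ∃[ t ] CapturedIn κ ρ t)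

IsCopNumber : Graph → ℕ → Set
IsCopNumber G c =
  CopsGuaranteeCapture G c × (∀ k → k ℕ.< c → ¬ CopsGuaranteeCapture G k)

Player : Set
Player = Fin 3

pattern P₁ = zero
pattern P₂ = suc zero
pattern P₃ = suc (suc zero)

next : Player → Player
next P₁ = P₂
next P₂ = P₃
next P₃ = P₁

module _ (G : Graph) where
  open Graph G

  record S : Set where
    constructor mkS
    field
      x¹ x² x³ : V
      mover    : Player

  open S

  data State : Set where
    ⟨_⟩ : S → State
    s̄   : State

  S̃¹ S̃² S_C : Pred S 0ℓ
  S̃¹ s = x¹ s ≡ x² s
  S̃² s = x² s ≡ x³ s
  S_C s = s ∈ S̃¹ ⊎ s ∈ S̃²

  at : S → Player → V
  at s P₁ = x¹ s
  at s P₂ = x² s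
  at s P₃ = x³ s

  data Action : Set where
    move : V → Action
    null : Action

  data A (m : Player) : State → Pred Action 0ℓ where
    step     : ∀ {s y} → ¬ s ∈ S_C → m ≡ mover s → y ∈ N[ at s m ] → A m ⟨ s ⟩ (move y)
    wait     : ∀ {s y} → ¬ s ∈ S_C → m ≢ mover s → y ≡ at s m → A m ⟨ s ⟩ (move y)
    captured : ∀ {s} → s ∈ S_C → A m ⟨ s ⟩ null
    ended    : A m s̄ null

  moveTo : S → V → S
  moveTo (mkS x y z P₁) a = mkS a y z (next P₁)
  moveTo (mkS x y z P₂) a = mkS x a z (next P₂)
  moveTo (mkS x y z P₃) a = mkS x y a (next P₃)

  -- Made total: only the values at actions permitted by A are ever used, so
  -- a null action at ⟨ s ⟩ means that s is a capture state.
  T : State → Action → State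
  T ⟨ s ⟩ (move a) = ⟨ moveTo s a ⟩
  T ⟨ s ⟩ null     = s̄
  T s̄     _        = s̄

  History : Set
  History = List⁺ State

  Strategy : Player → Set
  Strategy n = (h : History) → Σ[ a ∈ Action ] a ∈ A n (head h)

  Profile : Set
  Profile = (n : Player) → Strategy n

  _[_≔_] : Profile → (n : Player) → Strategy n → Profile
  (σ [ n ≔ τ ]) m with n ≟ m
  ... | yes refl = τ
  ... | no  _    = σ m

  -- On capture states every permitted action is null, so consulting the
  -- mover there gives the forced null move.
  chosen : Profile → History → Action
  chosen σ h = act (head h)
    where
    act : State → Action
    act ⟨ s ⟩ = proj₁ (σ (mover s) h)
    act s̄     = null

  history : S → Profile → ℕ → History
  history s₀ σ zero    = [ ⟨ s₀ ⟩ ]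
  history s₀ σ (suc t) = T (head h) (chosen σ h) ∷⁺ h
    where h = history s₀ σ t

  play : S → Profile → ℕ → State
  play s₀ σ t = head (history s₀ σ t)

  q : Player → State → ℚ
  q _  s̄     = 0ℚ
  q P₁ ⟨ s ⟩ = if does (x¹ s ≟ x² s) then 1ℚ else 0ℚ
  q P₂ ⟨ s ⟩ = if does (x¹ s ≟ x² s) then - 1ℚ else
               if does (x² s ≟ x³ s) then 1ℚ else 0ℚ
  q P₃ ⟨ s ⟩ = if does (x¹ s ≟ x² s) then 0ℚ else
               if does (x² s ≟ x³ s) then - 1ℚ else 0ℚ

  ∣q∣≤1 : ∀ n s → ∣ q n s ∣ ≤ 1ℚ
  ∣q∣≤1 n  s̄     = <⇒≤ (positive⁻¹ 1ℚ)
  ∣q∣≤1 P₁ ⟨ s ⟩ with does (x¹ s ≟ x² s)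
  ... | true  = ≤-refl
  ... | false = <⇒≤ (positive⁻¹ 1ℚ)
  ∣q∣≤1 P₂ ⟨ s ⟩ with does (x¹ s ≟ x² s) | does (x² s ≟ x³ s)
  ... | true  | _     = ≤-refl
  ... | false | true  = ≤-refl
  ... | false | false = <⇒≤ (positive⁻¹ 1ℚ)
  ∣q∣≤1 P₃ ⟨ s ⟩ with does (x¹ s ≟ x² s) | does (x² s ≟ x³ s)
  ... | true  | _     = <⇒≤ (positive⁻¹ 1ℚ)
  ... | false | true  = ≤-refl
  ... | false | false = <⇒≤ (positive⁻¹ 1ℚ)

  module _ (γ : ℝ) (0<γ : 0ᴿ <ᴿ γ) (γ<1 : γ <ᴿ 1ᴿ) where

    Q : Player → S → Profile → ℝ
    Q n s₀ σ = discountedSum γ 0<γ γ<1 (λ t → q n (play s₀ σ t)) (λ t → ∣q∣≤1 n (play s₀ σ t))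

    IsNashEquilibrium : S → Profile → Set
    IsNashEquilibrium s₀ σ = ∀ n (τ : Strategy n) → Q n s₀ (σ [ n ≔ τ ]) ≤ᴿ Q n s₀ σ

  NonCapturing : S → Profile → Set
  NonCapturing s₀ σ = ∀ t s → play s₀ σ t ≡ ⟨ s ⟩ → ¬ s ∈ S_C

{-# OPTIONS --safe #-}

-- Since one cop cannot win on G, every vertex x has a vertex y from which a
-- robber evades a cop starting at x forever.  Put P₁ anywhere, P₂ where it can
-- evade P₁, and P₃ where it can evade P₂.  If P₂ evades P₁ and P₃ evades P₂,
-- nobody is ever captured and all payoffs are 0.  A deviation of P₁ cannot capture P₂, one of P₂ cannot
-- capture P₃, and P₃ never receives a positive payoff.
module Submission where

open import Data.Fin.Base using (combine)
open import Data.Fin.Properties using (_≟_; any?; combine-injective)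
open import Data.Fin.Subset using (Subset; ⊤; _-_; _⊂_) renaming (_∈_ to _∈ˢ_; _∉_ to _∉ˢ_)
open import Data.Fin.Subset.Induction using (⊂-wellFounded; Acc; acc)
open import Data.Fin.Subset.Properties using (_∈?_; ∈⊤; x∈p⇒p-x⊂p; x∈p∧x≢y⇒x∈p-y)
open import Data.Integer.Base using (+_)
open import Data.List.Base using (List; []; _∷_)
open import Data.List.NonEmpty using (List⁺; _∷_; head)
open import Data.Nat.Base as ℕ using (ℕ; zero; suc; _<_)
import Data.Nat.Properties as ℕ
open import Data.Product using (Σ-syntax; ∃-syntax; _×_; _,_; proj₁; proj₂)
open import Data.Rational as ℚ using (ℚ; 0ℚ; 1ℚ; ½; nonNegative)
import Data.Rational.Properties as ℚ
open import Data.Rational.Solver using (module +-*-Solver)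
open import Data.Sum.Base using (_⊎_; inj₁; inj₂)
import Data.Unit.Base as Unit
open import Data.Vec.Base as Vec using (Vec; []; _∷_)
open import Data.Vec.Relation.Binary.Pointwise.Inductive as Pointwise using (Pointwise; []; _∷_)
open import Data.Vec.Relation.Unary.Any using (here)
open import Relation.Binary.PropositionalEquality using (_≡_; _≢_; refl; sym; trans; cong; cong₂; subst)
open import Relation.Nullary using (¬_; Dec; yes; no; contradiction)
open import Relation.Nullary.Decidable using (¬?; _×-dec_; _⊎-dec_; decidable-stable; dec-no)
open import Relation.Unary using (_∈_)
open import Defs

open +-*-Solver using (solve; _:=_; _:+_; _:*_; con)

-- Discounted sums

≤ᴿ-trans : ∀ {x y z} → x ≤ᴿ y → y ≤ᴿ z → x ≤ᴿ z
≤ᴿ-trans {x} {y} {z} x≤y y≤z ε 0<ε =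
  M ℕ.⊔ N , λ k le → begin
    approx x k                      ≤⟨ f k (ℕ.m⊔n≤o⇒m≤o M N le) ⟩
    approx y k ℚ.+ e                ≤⟨ ℚ.+-monoˡ-≤ e (g k (ℕ.m⊔n≤o⇒n≤o M N le)) ⟩
    (approx z k ℚ.+ e) ℚ.+ e        ≡⟨ ℚ.+-assoc (approx z k) e e ⟩
    approx z k ℚ.+ (e ℚ.+ e)        ≡⟨ cong (approx z k ℚ.+_) e+e≡ε ⟩
    approx z k ℚ.+ ε                ∎
  where
  open ℚ.≤-Reasoning
  e = ½ ℚ.* ε
  0<e : 0ℚ ℚ.< e
  0<e = subst (ℚ._< e) (ℚ.*-zeroʳ ½) (ℚ.*-monoʳ-<-pos ½ 0<ε)
  e+e≡ε : e ℚ.+ e ≡ ε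
  e+e≡ε = trans (sym (ℚ.*-distribʳ-+ ε ½ ½)) (ℚ.*-identityˡ ε)
  M = proj₁ (x≤y e 0<e)
  f = proj₂ (x≤y e 0<e)
  N = proj₁ (y≤z e 0<e)
  g = proj₂ (y≤z e 0<e)

+ᴿ-monoˡ : ∀ {x y} z → x ≤ᴿ y → x +ᴿ z ≤ᴿ y +ᴿ z
+ᴿ-monoˡ {x} {y} z x≤y ε 0<ε with N , f ← x≤y ε 0<ε =
  N , λ k le → begin
    approx x k ℚ.+ approx z k            ≤⟨ ℚ.+-monoˡ-≤ (approx z k) (f k le) ⟩
    (approx y k ℚ.+ ε) ℚ.+ approx z k    ≡⟨ ℚ.+-assoc (approx y k) ε (approx z k) ⟩
    approx y k ℚ.+ (ε ℚ.+ approx z k)    ≡⟨ cong (approx y k ℚ.+_) (ℚ.+-comm ε (approx z k)) ⟩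
    approx y k ℚ.+ (approx z k ℚ.+ ε)    ≡⟨ ℚ.+-assoc (approx y k) (approx z k) ε ⟨
    (approx y k ℚ.+ approx z k) ℚ.+ ε    ∎
  where open ℚ.≤-Reasoning

⅓ : ℚ
⅓ = + 1 ℚ./ 3

thirds : ∀ p ε → ((p ℚ.+ ⅓ ℚ.* ε) ℚ.+ ⅓ ℚ.* ε) ℚ.+ ⅓ ℚ.* ε ≡ p ℚ.+ ε
thirds = solve 2 (λ p ε →
  ((p :+ con ⅓ :* ε) :+ con ⅓ :* ε) :+ con ⅓ :* ε := p :+ ε) refl

-- The two slacks are those of the two limits in `HasSum-mono`; with the slack inside `_≤ᴿ_` itself,
-- three copies of a third of `ε` add up to `ε`.
≤ᴿ-closed : ∀ {x y} → (∀ ε → 0ℚ ℚ.< ε → x ≤ᴿ (y +ᴿ fromℚ ε) +ᴿ fromℚ ε) → x ≤ᴿ y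
≤ᴿ-closed {x} {y} h ε 0<ε with h e 0<e e 0<e
  where
  e = ⅓ ℚ.* ε
  0<e : 0ℚ ℚ.< e
  0<e = subst (ℚ._< e) (ℚ.*-zeroʳ ⅓) (ℚ.*-monoʳ-<-pos ⅓ 0<ε)
... | N , f = N , λ k le → subst (approx x k ℚ.≤_) (thirds (approx y k) ε) (f k le)

approx-^ᴿ-nonNeg : ∀ {γ k} → 0ℚ ℚ.≤ approx γ k → ∀ t → 0ℚ ℚ.≤ approx (γ ^ᴿ t) k
approx-^ᴿ-nonNeg 0≤γ zero = ℚ.<⇒≤ (ℚ.positive⁻¹ 1ℚ)
approx-^ᴿ-nonNeg {γ} {k} 0≤γ (suc t) =
  subst (ℚ._≤ approx γ k ℚ.* approx (γ ^ᴿ t) k) (ℚ.*-zeroʳ (approx γ k))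
    (ℚ.*-monoˡ-≤-nonNeg (approx γ k) {{nonNegative 0≤γ}} (approx-^ᴿ-nonNeg {γ} {k} 0≤γ t))

module _ {γ : ℝ} {c d : ℕ → ℚ} (c≤d : ∀ t → c t ℚ.≤ d t) where

  private
    term : (ℕ → ℚ) → ℕ → ℝ
    term a t = γ ^ᴿ t *ᴿ fromℚ (a t)

  approx-partialSum-mono : ∀ {k} → 0ℚ ℚ.≤ approx γ k → ∀ n →
    approx (partialSum (term c) n) k ℚ.≤ approx (partialSum (term d) n) k
  approx-partialSum-mono 0≤γ zero = ℚ.≤-refl
  approx-partialSum-mono {k} 0≤γ (suc n) = ℚ.+-mono-≤ (approx-partialSum-mono 0≤γ n)
    (ℚ.*-monoˡ-≤-nonNeg (approx (γ ^ᴿ n) k)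
      {{nonNegative (approx-^ᴿ-nonNeg {γ} {k} 0≤γ n)}} (c≤d n))

  partialSum-mono : 0ᴿ <ᴿ γ → ∀ n → partialSum (term c) n ≤ᴿ partialSum (term d) n
  partialSum-mono (η , 0<η , N , f) n ε 0<ε = N , λ k le →
    ℚ.≤-trans
      (approx-partialSum-mono
        -- Positivity of `γ` makes its approximations nonnegative only from index `N` on, so the
        -- comparison of approximations is only eventual.
        (ℚ.≤-trans (ℚ.<⇒≤ 0<η) (subst (ℚ._≤ approx γ k) (ℚ.+-identityˡ η) (f k le))) n)
      (ℚ.≤-trans (ℚ.≤-reflexive (sym (ℚ.+-identityʳ (D k)))) (ℚ.+-monoʳ-≤ (D k) (ℚ.<⇒≤ 0<ε)))
    where D = approx (partialSum (term d) n)

  -- Past both thresholds, `l` exceeds `C` by at most `ε`, `C` is at most `D`, and `D` exceeds `m`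
  -- by at most `ε`.
  HasSum-mono : 0ᴿ <ᴿ γ → ∀ {l m} → HasSum (term c) l → HasSum (term d) m → l ≤ᴿ m
  HasSum-mono 0<γ {l} {m} hc hd = ≤ᴿ-closed {l} {m} λ ε 0<ε →
    let M , f = hc ε 0<ε
        N , g = hd ε 0<ε
        n = M ℕ.⊔ N
        C = partialSum (term c) n
        D = partialSum (term d) n
    in ≤ᴿ-trans {l} {C +ᴿ fromℚ ε} {(m +ᴿ fromℚ ε) +ᴿ fromℚ ε}
         (proj₂ (f n (ℕ.m≤m⊔n M N)))
         (+ᴿ-monoˡ {C} {m +ᴿ fromℚ ε} (fromℚ ε)
           (≤ᴿ-trans {C} {D} {m +ᴿ fromℚ ε} (partialSum-mono 0<γ n)
             (proj₁ (g n (ℕ.m≤n⊔m M N)))))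

-- Evading a single pursuer

module _ (G : Graph) where
  open Graph G

  near? : ∀ x y → Dec (y ∈ N[ x ])
  near? x y = (y ≟ x) ⊎-dec (x ~? y)

  -- Winning trees of a pursuer at `x`, who is to move, against an evader at `y`. Being inductive,
  -- they force capture in finitely many rounds.
  data CopWin (x y : V) : Set where
    grab  : y ∈ N[ x ] → CopWin x y
    chase : ∀ x′ → x′ ∈ N[ x ] → (∀ {y′} → y′ ∈ N[ y ] → CopWin x′ y′) → CopWin x y

  -- Here the evader is to move, whereas `Safe` speaks of pairs with the pursuer to move.
  Evadable : (V → V → Set) → V → V → Set
  Evadable Safe x y = x ≢ y × (∃[ y′ ] (y′ ∈ N[ y ] × Safe x y′))

  record Haven : Set₁ where
    field
      Safe   : V → V → Set
      safe?  : ∀ x y → Dec (Safe x y)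
      escape : ∀ {x y x′} → Safe x y → x′ ∈ N[ x ] → Evadable Safe x′ y

    -- The pursuer may stay put, so `escape` applies to the current pair.
    safe⇒≢ : ∀ {x y} → Safe x y → x ≢ y
    safe⇒≢ s = proj₁ (escape s (inj₁ refl))

    flee : ∀ x y → Σ[ y′ ∈ V ] y′ ∈ N[ y ]
    flee x y with any? (λ y′ → near? y y′ ×-dec safe? x y′)
    ... | yes (y′ , y′∈ , _) = y′ , y′∈
    ... | no _               = y , inj₁ refl

    flee-safe : ∀ {x y} → Evadable Safe x y → Safe x (proj₁ (flee x y))
    flee-safe {x} {y} (_ , e) with any? (λ y′ → near? y y′ ×-dec safe? x y′)
    ... | yes (_ , _ , s) = s
    ... | no ¬e           = contradiction e ¬e

  open Haven

  -- A pair is removed from the candidate set when some pursuer move leaves the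
  -- evader no reply inside the set; it is then a win for the pursuer, because
  -- all pairs outside the set are.
  haven : Σ[ H ∈ Haven ] (∀ x y → Safe H x y ⊎ CopWin x y)
  haven = shrink ⊤ (⊂-wellFounded ⊤) (λ x y ∉⊤ → contradiction ∈⊤ ∉⊤)
    where
    shrink : (R : Subset (order ℕ.* order)) → Acc _⊂_ R →
      (∀ x y → combine x y ∉ˢ R → CopWin x y) →
      Σ[ H ∈ Haven ] (∀ x y → Safe H x y ⊎ CopWin x y)
    shrink R (acc rec) win = decide
      (any? λ x → any? λ y → inR? x y ×-dec any? λ x′ → near? x x′ ×-dec ¬? (evadable? x′ y))
      where
      InR : V → V → Set
      InR x y = combine x y ∈ˢ R

      inR? : ∀ x y → Dec (InR x y)
      inR? x y = combine x y ∈? R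

      evadable? : ∀ x y → Dec (Evadable InR x y)
      evadable? x y = ¬? (x ≟ y) ×-dec any? λ y′ → near? y y′ ×-dec inR? x y′

      decide : Dec (∃[ x ] ∃[ y ] (InR x y × ∃[ x′ ] (x′ ∈ N[ x ] × ¬ Evadable InR x′ y))) →
        Σ[ H ∈ Haven ] (∀ x y → Safe H x y ⊎ CopWin x y)
      decide (no ¬exit) = record
        { Safe   = InR
        ; safe?  = inR?
        ; escape = λ {x} {y} {x′} s x′∈ → decidable-stable (evadable? x′ y)
            λ ¬e → ¬exit (x , y , s , x′ , x′∈ , ¬e)
        } , dichotomy
        where
        dichotomy : ∀ x y → InR x y ⊎ CopWin x y
        dichotomy x y with inR? x y
        ... | yes r = inj₁ r
        ... | no ¬r = inj₂ (win x y ¬r)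
      decide (yes (x , y , r , x′ , x′∈ , ¬e)) =
        shrink (R - combine x y) (rec (x∈p⇒p-x⊂p r)) win′
        where
        winₓ : CopWin x y
        winₓ with x′ ≟ y
        ... | yes refl = grab x′∈
        -- A reply that kept the pair in `R` would make it evadable; so every reply leaves `R`,
        -- where the pursuer wins.
        ... | no x′≢y  = chase x′ x′∈ λ {y′} y′∈ → win x′ y′ λ r′ → ¬e (x′≢y , y′ , y′∈ , r′)

        win′ : ∀ u v → combine u v ∉ˢ R - combine x y → CopWin u v
        win′ u v ∉R with combine u v ≟ combine x y
        ... | no ≢    = win u v λ r′ → ∉R (x∈p∧x≢y⇒x∈p-y r′ ≢)
        ... | yes eq with refl , refl ← combine-injective u v x y eq = winₓ

  -- From winning trees to a strategy for one cop

  module _ (x₀ : V) (win : ∀ y → CopWin x₀ y) where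
    open Position

    private
      Pursuit : Set
      Pursuit = Σ[ x ∈ V ] Σ[ y ∈ V ] CopWin x y

      -- Descends along the branch picked by the robber's move to `y′`. The restart at `x₀` is a
      -- default for illegal moves and for rounds after a grab, which `catches` never meets.
      advance : Pursuit → V → Pursuit
      advance (x , y , chase x′ _ f) y′ with near? y y′
      ... | yes y′∈ = x′ , y′ , f y′∈
      ... | no _    = x₀ , y′ , win y′
      advance (x , y , grab _) y′ = x₀ , y′ , win y′

      -- The membership proof is existential because `near?` finds its own, and the subtree given by
      -- `f` may depend on it.
      advance-near : ∀ {x y x′ x′∈ y′} (f : ∀ {v} → v ∈ N[ y ] → CopWin x′ v) → y′ ∈ N[ y ] →
        ∃[ y′∈ ] advance (x , y , chase x′ x′∈ f) y′ ≡ (x′ , y′ , f y′∈)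
      advance-near {y = y} {y′ = y′} f y′∈ with near? y y′
      ... | yes y′∈ = y′∈ , refl
      ... | no ¬y′∈ = contradiction y′∈ ¬y′∈

      -- CopWin need not be unique at a pair, so the cop replays the history to
      -- find the subtree it has reached of the winning tree chosen at the start.
      pursuit : List⁺ (Position G 1) → Pursuit
      pursuit (p ∷ ps) = go (robber p) ps
        where
        go : V → List (Position G 1) → Pursuit
        go y []       = x₀ , y , win y
        go y (p ∷ ps) = advance (go (robber p) ps) y

      target : Pursuit → V
      target (_ , y , grab _)       = y
      target (_ , _ , chase x′ _ _) = x′

      target-near : ∀ ((x , y , w) : Pursuit) → target (x , y , w) ∈ N[ x ]
      target-near (_ , _ , grab y∈)       = y∈
      target-near (_ , _ , chase _ x′∈ _) = x′∈

      towards : ∀ x z → Σ[ x′ ∈ V ] x′ ∈ N[ x ]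
      towards x z with near? x z
      ... | yes z∈ = z , z∈
      -- An arbitrary history need not place the cop where `pursuit` expects it; staying put is then
      -- legal.
      ... | no _   = x , inj₁ refl

      towards-near : ∀ {x z} → z ∈ N[ x ] → proj₁ (towards x z) ≡ z
      towards-near {x} {z} z∈ with near? x z
      ... | yes _  = refl
      ... | no ¬z∈ = contradiction z∈ ¬z∈

      pointwise : ∀ {x} (xs : Vec V 1) → x ∈ N[ Vec.head xs ] →
        Pointwise (λ u v → v ∈ N[ u ]) xs (x ∷ [])
      pointwise (_ ∷ []) x∈ = x∈ ∷ []

      pursue : CopStrategy G 1
      pursue = record
        { place = x₀ ∷ []
        ; move  = λ h → let x , x∈ = towards (Vec.head (cops (head h))) (target (pursuit h)) in
                    x ∷ [] , pointwise (cops (head h)) x∈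
        }

      -- Structural recursion on the winning tree: as long as replay and board agree, each round
      -- passes to a subtree, until a `grab`.
      catches : ∀ ρ t {x y} (w : CopWin x y) → pursuit (rounds G 1 pursue ρ t) ≡ (x , y , w) →
        head (rounds G 1 pursue ρ t) ≡ mkPosition (x ∷ []) y → ∃[ u ] CapturedIn G 1 pursue ρ u
      catches ρ t {x} {y} w plan pos = continue w plan
        where
        h = rounds G 1 pursue ρ t
        x⁺ = proj₁ (towards (Vec.head (cops (head h))) (target (pursuit h)))
        y⁺ = RobberStrategy.move ρ h (x⁺ ∷ [])

        moved : ∀ {w} → pursuit h ≡ (x , y , w) → x⁺ ≡ target (x , y , w)
        moved {w} plan = trans
          (cong₂ (λ u v → proj₁ (towards u v)) (cong (λ p → Vec.head (cops p)) pos) (cong target plan))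
          (towards-near (target-near (x , y , w)))

        continue : ∀ w → pursuit h ≡ (x , y , w) → ∃[ u ] CapturedIn G 1 pursue ρ u
        continue (grab y∈) plan = t , inj₂ (here (trans (cong robber pos) (sym (moved plan))))
        continue (chase x′ x′∈ f) plan = catches ρ (suc t) (f y⁺∈) plan⁺
          (cong (λ z → mkPosition (z ∷ []) (proj₁ y⁺)) (moved plan))
          where
          reached = advance-near {x′∈ = x′∈} f (subst (λ p → proj₁ y⁺ ∈ N[ robber p ]) pos (proj₂ y⁺))
          y⁺∈ = proj₁ reached

          plan⁺ : pursuit (rounds G 1 pursue ρ (suc t)) ≡ (x′ , proj₁ y⁺ , f y⁺∈)
          plan⁺ = trans (cong (λ π → advance π (proj₁ y⁺)) plan) (proj₂ reached)

    copsGuaranteeCapture : CopsGuaranteeCapture G 1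
    copsGuaranteeCapture = pursue , λ ρ → catches ρ 0 (win _) refl refl

  -- On the empty graph the robber cannot be placed, so zero cops win vacuously. Hence a cop number
  -- above 1 yields a vertex.
  copless-win : ¬ V → CopsGuaranteeCapture G 0
  copless-win ¬v =
    record { place = [] ; move = λ h → _ , Pointwise.refl (inj₁ refl) } ,
    λ ρ → contradiction (RobberStrategy.place ρ []) ¬v

  vertex : ¬ CopsGuaranteeCapture G 0 → V
  vertex ¬win with any? {P = λ (_ : V) → Unit.⊤} (λ _ → yes Unit.tt)
  ... | yes (x , _) = x
  ... | no ¬v       = contradiction (copless-win λ x → ¬v (x , Unit.tt)) ¬win

  -- If no `y` were safe from `x`, the pursuer would have a winning tree against every `y`, and a
  -- single cop placed at `x` would win.
  safe-vertex : ¬ CopsGuaranteeCapture G 1 → ∀ x → ∃[ y ] Safe (proj₁ haven) x y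
  safe-vertex ¬win x with any? (safe? (proj₁ haven) x)
  ... | yes s = s
  ... | no ¬s = contradiction (copsGuaranteeCapture x win) ¬win
    where
    win : ∀ y → CopWin x y
    win y with proj₂ haven x y
    ... | inj₁ s = contradiction (y , s) ¬s
    ... | inj₂ w = w

-- The pursuit game

module _ (G : Graph) where
  open Graph G
  open Haven

  S_C? : ∀ s → Dec (s ∈ S_C G)
  S_C? (mkS x y z _) = (x ≟ y) ⊎-dec (y ≟ z)

  positional : (∀ n (s : S G) → Σ[ y ∈ V ] y ∈ N[ at G s n ]) → Profile G
  positional ρ n (s̄ ∷ _) = null , ended
  positional ρ n (⟨ s ⟩ ∷ _) with S_C? s | n ≟ S.mover s
  ... | yes c | _     = null , captured c
  ... | no ¬c | yes m = let y , y∈ = ρ n s in move y , step ¬c m y∈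
  ... | no ¬c | no ¬m = move (at G s n) , wait ¬c ¬m refl

  -- The evasion profile and its invariants

  module _ (H : Haven G) where

    evasion : Profile G
    evasion = positional reply
      where
      reply : ∀ n (s : S G) → Σ[ y ∈ V ] y ∈ N[ at G s n ]
      reply P₁ (mkS x y z _) = x , inj₁ refl
      reply P₂ (mkS x y z _) = flee H x y
      reply P₃ (mkS x y z _) = flee H y z

    -- Each evader moves right after its pursuer, so its pair is `Safe` except on the evader's own
    -- turn, when it is `Evadable`. Nothing is asked of `s̄`, where all payoffs vanish.
    Evading₂ Evading₃ : State G → Set
    Evading₂ s̄ = Unit.⊤
    Evading₂ ⟨ mkS x y z P₁ ⟩ = Safe H x y
    Evading₂ ⟨ mkS x y z P₂ ⟩ = Evadable G (Safe H) x y
    Evading₂ ⟨ mkS x y z P₃ ⟩ = Safe H x y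
    Evading₃ s̄ = Unit.⊤
    Evading₃ ⟨ mkS x y z P₁ ⟩ = Safe H y z
    Evading₃ ⟨ mkS x y z P₂ ⟩ = Safe H y z
    Evading₃ ⟨ mkS x y z P₃ ⟩ = Evadable G (Safe H) y z

    evading₂⇒≢ : ∀ {x y z} p → Evading₂ ⟨ mkS x y z p ⟩ → x ≢ y
    evading₂⇒≢ P₁ = safe⇒≢ H
    evading₂⇒≢ P₂ = proj₁
    evading₂⇒≢ P₃ = safe⇒≢ H

    evading₃⇒≢ : ∀ {x y z} p → Evading₃ ⟨ mkS x y z p ⟩ → y ≢ z
    evading₃⇒≢ P₁ = safe⇒≢ H
    evading₃⇒≢ P₂ = safe⇒≢ H
    evading₃⇒≢ P₃ = proj₁

    module _ (σ : Profile G) where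

      -- Only the strategy of P₂ is fixed, so the invariant survives any deviation of P₁ as well.
      evading₂-step : σ P₂ ≡ evasion P₂ → ∀ h → Evading₂ (head h) →
        Evading₂ (T G (head h) (chosen G σ h))
      evading₂-step σ₂ (s̄ ∷ _) e = Unit.tt
      evading₂-step σ₂ h@(⟨ mkS x y z P₁ ⟩ ∷ _) e with σ P₁ h
      ... | move a , step _ _ a∈ = escape H e a∈
      ... | move a , wait _ ≢ _  = contradiction refl ≢
      ... | null , _             = Unit.tt
      evading₂-step σ₂ h@(⟨ s@(mkS x y z P₂) ⟩ ∷ _) e rewrite σ₂ with S_C? s
      -- P₂ and P₃ may share a vertex here, since P₃ plays arbitrarily; the play then passes to
      -- `s̄`.
      ... | yes _ = Unit.tt
      ... | no _  = flee-safe H e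
      evading₂-step σ₂ h@(⟨ mkS x y z P₃ ⟩ ∷ _) e with σ P₃ h
      ... | move a , _ = e
      ... | null , _   = Unit.tt

      evading₃-step : σ P₃ ≡ evasion P₃ → ∀ h → Evading₃ (head h) →
        Evading₃ (T G (head h) (chosen G σ h))
      evading₃-step σ₃ (s̄ ∷ _) e = Unit.tt
      evading₃-step σ₃ h@(⟨ mkS x y z P₁ ⟩ ∷ _) e with σ P₁ h
      ... | move a , _ = e
      ... | null , _   = Unit.tt
      evading₃-step σ₃ h@(⟨ mkS x y z P₂ ⟩ ∷ _) e with σ P₂ h
      ... | move a , step _ _ a∈ = escape H e a∈
      ... | move a , wait _ ≢ _  = contradiction refl ≢
      ... | null , _             = Unit.tt
      evading₃-step σ₃ h@(⟨ s@(mkS x y z P₃) ⟩ ∷ _) e rewrite σ₃ with S_C? s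
      ... | yes _ = Unit.tt
      ... | no _  = flee-safe H e

      play-evading₂ : σ P₂ ≡ evasion P₂ → ∀ {s₀} → Evading₂ ⟨ s₀ ⟩ →
        ∀ t → Evading₂ (play G s₀ σ t)
      play-evading₂ σ₂ e zero = e
      play-evading₂ σ₂ {s₀} e (suc t) =
        evading₂-step σ₂ (history G s₀ σ t) (play-evading₂ σ₂ e t)

      play-evading₃ : σ P₃ ≡ evasion P₃ → ∀ {s₀} → Evading₃ ⟨ s₀ ⟩ →
        ∀ t → Evading₃ (play G s₀ σ t)
      play-evading₃ σ₃ e zero = e
      play-evading₃ σ₃ {s₀} e (suc t) =
        evading₃-step σ₃ (history G s₀ σ t) (play-evading₃ σ₃ e t)

    -- Payoffs under evasion and under deviations

    -1ℚ≤0ℚ : ℚ.- 1ℚ ℚ.≤ 0ℚ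
    -1ℚ≤0ℚ = ℚ.neg-antimono-≤ (ℚ.<⇒≤ (ℚ.positive⁻¹ 1ℚ))

    evading⇒q≡0 : ∀ n s → Evading₂ s → Evading₃ s → q G n s ≡ 0ℚ
    evading⇒q≡0 P₁ s̄ _ _ = refl
    evading⇒q≡0 P₂ s̄ _ _ = refl
    evading⇒q≡0 P₃ s̄ _ _ = refl
    evading⇒q≡0 n ⟨ mkS x y z p ⟩ e₂ e₃ with n | x ≟ y | y ≟ z
    ... | _  | yes x≡y | _       = contradiction x≡y (evading₂⇒≢ p e₂)
    ... | _  | no _    | yes y≡z = contradiction y≡z (evading₃⇒≢ p e₃)
    ... | P₁ | no x≢y  | no y≢z rewrite dec-no (x ≟ y) x≢y = refl
    ... | P₂ | no x≢y  | no y≢z rewrite dec-no (x ≟ y) x≢y | dec-no (y ≟ z) y≢z = refl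
    ... | P₃ | no x≢y  | no y≢z rewrite dec-no (x ≟ y) x≢y | dec-no (y ≟ z) y≢z = refl

    evading₂⇒q₁≤0 : ∀ s → Evading₂ s → q G P₁ s ℚ.≤ 0ℚ
    evading₂⇒q₁≤0 s̄ _ = ℚ.≤-refl
    evading₂⇒q₁≤0 ⟨ mkS x y z p ⟩ e with x ≟ y
    ... | yes x≡y = contradiction x≡y (evading₂⇒≢ p e)
    ... | no _    = ℚ.≤-refl

    evading₃⇒q₂≤0 : ∀ s → Evading₃ s → q G P₂ s ℚ.≤ 0ℚ
    evading₃⇒q₂≤0 s̄ _ = ℚ.≤-refl
    evading₃⇒q₂≤0 ⟨ mkS x y z p ⟩ e with x ≟ y | y ≟ z
    -- A deviating P₂ may be captured by P₁, which only costs it.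
    ... | yes _ | _       = -1ℚ≤0ℚ
    ... | no _  | yes y≡z = contradiction y≡z (evading₃⇒≢ p e)
    ... | no _  | no _    = ℚ.≤-refl

    q₃≤0 : ∀ s → q G P₃ s ℚ.≤ 0ℚ
    q₃≤0 s̄ = ℚ.≤-refl
    q₃≤0 ⟨ mkS x y z _ ⟩ with x ≟ y | y ≟ z
    ... | yes _ | _     = ℚ.≤-refl
    ... | no _  | yes _ = -1ℚ≤0ℚ
    ... | no _  | no _  = ℚ.≤-refl

    module _ {s₀ : S G} (e₂ : Evading₂ ⟨ s₀ ⟩) (e₃ : Evading₃ ⟨ s₀ ⟩) where

      evasion-nonCapturing : NonCapturing G s₀ evasion
      evasion-nonCapturing t (mkS x y z p) eq = λ
        { (inj₁ x≡y) → evading₂⇒≢ p (subst Evading₂ eq (play-evading₂ evasion refl e₂ t)) x≡y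
        ; (inj₂ y≡z) → evading₃⇒≢ p (subst Evading₃ eq (play-evading₃ evasion refl e₃ t)) y≡z
        }

      evasion-payoff : ∀ n t → q G n (play G s₀ evasion t) ≡ 0ℚ
      evasion-payoff n t = evading⇒q≡0 n (play G s₀ evasion t)
        (play-evading₂ evasion refl e₂ t) (play-evading₃ evasion refl e₃ t)

      deviation-payoff : ∀ n τ t → q G n (play G s₀ (_[_≔_] G evasion n τ) t) ℚ.≤ 0ℚ
      deviation-payoff P₁ τ t = evading₂⇒q₁≤0 (play G s₀ σ t) (play-evading₂ σ refl e₂ t)
        where σ = _[_≔_] G evasion P₁ τ
      deviation-payoff P₂ τ t = evading₃⇒q₂≤0 (play G s₀ σ t) (play-evading₃ σ refl e₃ t)
        where σ = _[_≔_] G evasion P₂ τ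
      deviation-payoff P₃ τ t = q₃≤0 (play G s₀ (_[_≔_] G evasion P₃ τ) t)

      -- The comparison holds turn by turn: a deviator gets at most 0 where `evasion` gives exactly
      -- 0, and discounting keeps the order.
      evasion-isNashEquilibrium : ∀ γ 0<γ γ<1 → IsNashEquilibrium G γ 0<γ γ<1 s₀ evasion
      evasion-isNashEquilibrium γ 0<γ γ<1 n τ = HasSum-mono {γ} {payoff σ} {payoff evasion}
        (λ t → ℚ.≤-trans (deviation-payoff n τ t) (ℚ.≤-reflexive (sym (evasion-payoff n t))))
        0<γ {Q G γ 0<γ γ<1 n s₀ σ} {Q G γ 0<γ γ<1 n s₀ evasion}
        (discounted σ) (discounted evasion)
        where
        σ = _[_≔_] G evasion n τ
        payoff : Profile G → ℕ → ℚ
        payoff σ t = q G n (play G s₀ σ t)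
        discounted : ∀ σ → HasSum (λ t → γ ^ᴿ t *ᴿ fromℚ (payoff σ t)) (Q G γ 0<γ γ<1 n s₀ σ)
        discounted σ = discountedSum-HasSum γ 0<γ γ<1 (payoff σ) (λ t → ∣q∣≤1 G n (play G s₀ σ t))

theorem5p13 : (G : Graph) (c : ℕ) → IsCopNumber G c → 1 < c →
    (γ : ℝ) (0<γ : 0ᴿ <ᴿ γ) (γ<1 : γ <ᴿ 1ᴿ) →
    ∃[ s₀ ] ∃[ σ̂ ] (IsNashEquilibrium G γ 0<γ γ<1 s₀ σ̂ × NonCapturing G s₀ σ̂)
theorem5p13 G c (_ , ¬win) 1<c γ 0<γ γ<1 =
  let H         = proj₁ (haven G)
      x         = vertex G (¬win 0 (ℕ.<-trans ℕ.z<s 1<c))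
      y , safe₂ = safe-vertex G (¬win 1 1<c) x
      z , safe₃ = safe-vertex G (¬win 1 1<c) y
  -- With P₁ to move first, both invariants at the start are plain `Safe`.
  in mkS x y z P₁ , evasion G H ,
     evasion-isNashEquilibrium G H safe₂ safe₃ γ 0<γ γ<1 ,
     evasion-nonCapturing G H safe₂ safe₃
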